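{- Let $\mathcal{SP}$ be the set of primes that divide some term of Sylvester's sequence. For any product $c=\prod p_i$ of (finitely many) distinct primes $p_i\in\mathcal{SP}$, there is some $n$ such that the cyclic group $\mathbb{Z}/c\mathbb{Z}$ is (up to isomorphism) the critical group of an arithmetical structure on $S_n$ and also the critical group of an arithmetical structure on $K_n$.
   Context: Sylvester's sequence $(s_m)_{m\geq 1}$ is defined by $s_1=2$ and $s_{m+1}=s_m^2-s_m+1$. An arithmetical structure on a finite, connected, loopless graph $G$ with vertex set $V(G)$ is a pair $(\mathbf{d},\mathbf{r})$, where $\mathbf{r}=(r_v)_{v\in V(G)}$ consists of positive integers with no common factor, $\mathbf{d}=(d_v)_{v\in V(G)}$ consists of nonnegative integers, and for every vertex $v$ we have $r_vd_v=\sum r_u$, the sum being over all $u$ adjacent to $v$ (with multiplicity for multigraphs). Its critical group $\mathcal{K}(G;\mathbf{d},\mathbf{r})$ is the torsion part of the cokernel (over $\mathbb{Z}$) of the matrix $L(G,\mathbf{d})=\operatorname{diag}(\mathbf{d})-A(G)$, where $A(G)$ is the adjacency matrix of $G$. The star graph $S_n$ has $n$ leaves $v_1,\dotsc,v_n$, each joined by one edge to a central vertex $v_0$ (and no other edges). $K_n$ denotes the (simple) complete graph on $n$ vertices. -}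

module Defs where

open import Algebra.Bundles using (AbelianGroup)
import Algebra.Construct.Pointwise as Pointwise
import Algebra.Definitions.RawMonoid as RawMonoid
open import Algebra.Morphism.Structures using (IsGroupHomomorphism; IsGroupIsomorphism)
import Algebra.Properties.AbelianGroup as AbelianGroupProperties
import Algebra.Properties.CommutativeMonoid.Mult as Multiples
import Algebra.Properties.CommutativeSemigroup as CommutativeSemigroupProperties
import Algebra.Properties.Semiring.Sum as Sum
open import Data.Bool.Base using (if_then_else_)
open import Data.Fin.Base using (Fin; zero; suc)
open import Data.Fin.Properties using (_≟_)
open import Data.Integer.Base as ℤ using (ℤ; +_; 0ℤ; -1ℤ)
import Data.Integer.Properties as ℤ
open import Data.Nat.Base as ℕ using (ℕ; zero; suc; _+_; _*_; _∸_; _^_; _<_; z<s; NonZero)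
open import Data.Nat.Divisibility using (_∣_)
open import Data.Nat.Primality using (Prime)
import Data.Nat.Properties as ℕ
open import Data.Product.Base using (Σ; ∃; ∃-syntax; Σ-syntax; _×_; _,_; proj₁)
open import Level using (Level; _⊔_; 0ℓ)
open import Relation.Binary.Construct.Closure.ReflexiveTransitive using (Star; ε; _◅_)
open import Relation.Binary.PropositionalEquality using (_≡_; refl; sym; trans; cong)
open import Relation.Nullary using (Dec; yes; no; does; contradiction)

private
  variable
    a ℓa b ℓb : Level

-- The index is shifted by one: sylvester k is s_{k+1}.  The truncated
-- subtraction is exact, since s ≤ s ^ 2.
sylvester : ℕ → ℕ
sylvester zero    = 2
sylvester (suc k) = sylvester k ^ 2 ∸ sylvester k + 1

𝒮𝒫 : ℕ → Set
𝒮𝒫 p = Prime p × ∃[ k ] p ∣ sylvester k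

infix 4 _≅_
_≅_ : AbelianGroup a ℓa → AbelianGroup b ℓb → Set (a ⊔ ℓa ⊔ b ⊔ ℓb)
A ≅ B = ∃ (IsGroupIsomorphism (AbelianGroup.rawGroup A) (AbelianGroup.rawGroup B))

module _ (A : AbelianGroup a ℓa) (B : AbelianGroup b ℓb) where
  private
    module A = AbelianGroup A
    module B = AbelianGroup B
    open AbelianGroupProperties B using (⁻¹-anti-homo‿-; ⁻¹-∙-comm)
    open CommutativeSemigroupProperties B.commutativeSemigroup using (interchange)
    open import Relation.Binary.Reasoning.Setoid B.setoid

  -- The carrier is that of B; two elements are identified when they differ by
  -- an element of the image.
  cokernel : (f : A.Carrier → B.Carrier) →
             IsGroupHomomorphism A.rawGroup B.rawGroup f →
             AbelianGroup b (a ⊔ ℓb)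
  cokernel f f-homo = record
    { Carrier = B.Carrier
    ; _≈_     = _∼_
    ; _∙_     = B._∙_
    ; ε       = B.ε
    ; _⁻¹     = B._⁻¹
    ; isAbelianGroup = record
      { isGroup = record
        { isMonoid = record
          { isSemigroup = record
            { isMagma = record
              { isEquivalence = record
                { refl  = ≈⇒∼ B.refl
                ; sym   = ∼-sym
                ; trans = ∼-trans
                }
              ; ∙-cong = ∼-∙-cong
              }
            ; assoc = λ x y z → ≈⇒∼ (B.assoc x y z)
            }
          ; identity = (λ x → ≈⇒∼ (B.identityˡ x)) , (λ x → ≈⇒∼ (B.identityʳ x))
          }
        ; inverse = (λ x → ≈⇒∼ (B.inverseˡ x)) , (λ x → ≈⇒∼ (B.inverseʳ x))
        ; ⁻¹-cong = ∼-⁻¹-cong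
        }
      ; comm = λ x y → ≈⇒∼ (B.comm x y)
      }
    }
    where
    module f = IsGroupHomomorphism f-homo

    _∼_ : B.Carrier → B.Carrier → Set (a ⊔ ℓb)
    x ∼ y = ∃[ z ] (x B.- y) B.≈ f z

    ≈⇒∼ : ∀ {x y} → x B.≈ y → x ∼ y
    ≈⇒∼ {x} {y} x≈y = A.ε , (begin
      x B.- y  ≈⟨ B.∙-congʳ x≈y ⟩
      y B.- y  ≈⟨ B.inverseʳ y ⟩
      B.ε      ≈⟨ f.ε-homo ⟨
      f A.ε    ∎)

    ∼-sym : ∀ {x y} → x ∼ y → y ∼ x
    ∼-sym {x} {y} (z , p) = z A.⁻¹ , (begin
      y B.- x         ≈⟨ ⁻¹-anti-homo‿- x y ⟨
      (x B.- y) B.⁻¹  ≈⟨ B.⁻¹-cong p ⟩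
      f z B.⁻¹        ≈⟨ f.⁻¹-homo z ⟨
      f (z A.⁻¹)      ∎)

    ∼-trans : ∀ {x y z} → x ∼ y → y ∼ z → x ∼ z
    ∼-trans {x} {y} {z} (u , p) (v , q) = u A.∙ v , (begin
      x B.- z                                 ≈⟨ B.∙-congʳ (B.identityʳ x) ⟨
      (x B.∙ B.ε) B.- z                       ≈⟨ B.∙-congʳ (B.∙-congˡ (B.inverseˡ y)) ⟨
      (x B.∙ (y B.⁻¹ B.∙ y)) B.- z            ≈⟨ B.∙-congʳ (B.assoc x (y B.⁻¹) y) ⟨
      ((x B.- y) B.∙ y) B.- z                 ≈⟨ B.assoc (x B.- y) y (z B.⁻¹) ⟩
      (x B.- y) B.∙ (y B.- z)                 ≈⟨ B.∙-cong p q ⟩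
      f u B.∙ f v                             ≈⟨ f.homo u v ⟨
      f (u A.∙ v)                             ∎)

    ∼-∙-cong : ∀ {x y u v} → x ∼ y → u ∼ v → (x B.∙ u) ∼ (y B.∙ v)
    ∼-∙-cong {x} {y} {u} {v} (s , p) (t , q) = s A.∙ t , (begin
      (x B.∙ u) B.- (y B.∙ v)                 ≈⟨ B.∙-congˡ (⁻¹-∙-comm y v) ⟨
      (x B.∙ u) B.∙ (y B.⁻¹ B.∙ v B.⁻¹)       ≈⟨ interchange x u (y B.⁻¹) (v B.⁻¹) ⟩
      (x B.- y) B.∙ (u B.- v)                 ≈⟨ B.∙-cong p q ⟩
      f s B.∙ f t                             ≈⟨ f.homo s t ⟨
      f (s A.∙ t)                             ∎)

    ∼-⁻¹-cong : ∀ {x y} → x ∼ y → (x B.⁻¹) ∼ (y B.⁻¹)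
    ∼-⁻¹-cong {x} {y} (z , p) = z A.⁻¹ , (begin
      (x B.⁻¹) B.- (y B.⁻¹)  ≈⟨ ⁻¹-∙-comm x (y B.⁻¹) ⟩
      (x B.- y) B.⁻¹         ≈⟨ B.⁻¹-cong p ⟩
      f z B.⁻¹               ≈⟨ f.⁻¹-homo z ⟨
      f (z A.⁻¹)             ∎)

module _ (A : AbelianGroup a ℓa) where
  private
    module A = AbelianGroup A
    open RawMonoid A.rawMonoid using () renaming (_×_ to _·_)
    open Multiples A.commutativeMonoid
      using (×-distrib-+; ×-assocˡ; ×-congʳ; ×-congˡ)
    open import Relation.Binary.Reasoning.Setoid A.setoid

  IsTorsion : A.Carrier → Set ℓa
  IsTorsion x = ∃[ k ] 0 < k × (k · x) A.≈ A.ε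

  private
    ·-ε : ∀ k → (k · A.ε) A.≈ A.ε
    ·-ε zero    = A.refl
    ·-ε (suc k) = A.trans (A.identityˡ _) (·-ε k)

    ·-multiple : ∀ {x} m k → (k · x) A.≈ A.ε → ((m * k) · x) A.≈ A.ε
    ·-multiple {x} m k kx≈ε = begin
      (m * k) · x  ≈⟨ ×-assocˡ x m k ⟨
      m · (k · x)  ≈⟨ ×-congʳ m kx≈ε ⟩
      m · A.ε      ≈⟨ ·-ε m ⟩
      A.ε          ∎

    torsion-∙ : ∀ {x y} → IsTorsion x → IsTorsion y → IsTorsion (x A.∙ y)
    torsion-∙ {x} {y} (k , 0<k , p) (l , 0<l , q) = k * l , ℕ.*-mono-< 0<k 0<l , (begin
      (k * l) · (x A.∙ y)              ≈⟨ ×-distrib-+ x y (k * l) ⟩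
      ((k * l) · x) A.∙ ((k * l) · y)  ≈⟨ A.∙-congʳ (×-congˡ (ℕ.*-comm k l)) ⟩
      ((l * k) · x) A.∙ ((k * l) · y)  ≈⟨ A.∙-cong (·-multiple l k p) (·-multiple k l q) ⟩
      A.ε A.∙ A.ε                      ≈⟨ A.identityˡ A.ε ⟩
      A.ε                              ∎)

    torsion-⁻¹ : ∀ {x} → IsTorsion x → IsTorsion (x A.⁻¹)
    torsion-⁻¹ {x} (k , 0<k , p) = k , 0<k , (begin
      k · (x A.⁻¹)                  ≈⟨ A.identityˡ _ ⟨
      A.ε A.∙ (k · (x A.⁻¹))        ≈⟨ A.∙-congʳ p ⟨
      (k · x) A.∙ (k · (x A.⁻¹))    ≈⟨ ×-distrib-+ x (x A.⁻¹) k ⟨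
      k · (x A.∙ x A.⁻¹)            ≈⟨ ×-congʳ k (A.inverseʳ x) ⟩
      k · A.ε                       ≈⟨ ·-ε k ⟩
      A.ε                           ∎)

  torsionSubgroup : AbelianGroup (a ⊔ ℓa) ℓa
  torsionSubgroup = record
    { Carrier = Σ A.Carrier IsTorsion
    ; _≈_     = λ x y → proj₁ x A.≈ proj₁ y
    ; _∙_     = λ (x , s) (y , t) → x A.∙ y , torsion-∙ s t
    ; ε       = A.ε , 1 , z<s , A.identityˡ A.ε
    ; _⁻¹     = λ (x , s) → x A.⁻¹ , torsion-⁻¹ s
    ; isAbelianGroup = record
      { isGroup = record
        { isMonoid = record
          { isSemigroup = record
            { isMagma = record
              { isEquivalence = record { refl = A.refl ; sym = A.sym ; trans = A.trans }
              ; ∙-cong = A.∙-cong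
              }
            ; assoc = λ _ _ _ → A.assoc _ _ _
            }
          ; identity = (λ _ → A.identityˡ _) , (λ _ → A.identityʳ _)
          }
        ; inverse = (λ _ → A.inverseˡ _) , (λ _ → A.inverseʳ _)
        ; ⁻¹-cong = A.⁻¹-cong
        }
      ; comm = λ _ _ → A.comm _ _
      }
    }

private
  *-isGroupHomomorphism : ∀ c → let ℤ⁺ = AbelianGroup.rawGroup ℤ.+-0-abelianGroup in
                          IsGroupHomomorphism ℤ⁺ ℤ⁺ (c ℤ.*_)
  *-isGroupHomomorphism c = record
    { isMonoidHomomorphism = record
      { isMagmaHomomorphism = record
        { isRelHomomorphism = record { cong = cong (c ℤ.*_) }
        ; homo = ℤ.*-distribˡ-+ c
        }
      ; ε-homo = ℤ.*-zeroʳ c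
      }
    ; ⁻¹-homo = λ x → sym (ℤ.neg-distribʳ-* c x)
    }

ℤ/_ : ℕ → AbelianGroup 0ℓ 0ℓ
ℤ/ c = cokernel ℤ.+-0-abelianGroup ℤ.+-0-abelianGroup (+ c ℤ.*_) (*-isGroupHomomorphism (+ c))

Matrix : ℕ → ℕ → Set
Matrix m n = Fin m → Fin n → ℤ

ℤ^_ : ℕ → AbelianGroup 0ℓ 0ℓ
ℤ^ n = Pointwise.abelianGroup (Fin n) ℤ.+-0-abelianGroup

diag : ∀ {n} → (Fin n → ℤ) → Matrix n n
diag d i j = if does (i ≟ j) then d i else 0ℤ

module _ {m n : ℕ} (M : Matrix m n) where
  open Sum ℤ.+-*-semiring using (sum; sum-cong-≋; ∑-distrib-+; *-distribˡ-sum; sum-replicate-zero)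

  infixr 7 _*ᵥ_
  _*ᵥ_ : (Fin n → ℤ) → (Fin m → ℤ)
  _*ᵥ_ x i = sum λ j → M i j ℤ.* x j

  *ᵥ-isGroupHomomorphism : IsGroupHomomorphism (AbelianGroup.rawGroup (ℤ^ n))
                                               (AbelianGroup.rawGroup (ℤ^ m)) _*ᵥ_
  *ᵥ-isGroupHomomorphism = record
    { isMonoidHomomorphism = record
      { isMagmaHomomorphism = record
        { isRelHomomorphism = record
          { cong = λ x≈y i → sum-cong-≋ λ j → cong (M i j ℤ.*_) (x≈y j) }
        ; homo = λ x y i → trans
            (sum-cong-≋ λ j → ℤ.*-distribˡ-+ (M i j) (x j) (y j))
            (∑-distrib-+ (λ j → M i j ℤ.* x j) (λ j → M i j ℤ.* y j))
        }
      ; ε-homo = λ i → trans (sum-cong-≋ λ j → ℤ.*-zeroʳ (M i j)) (sum-replicate-zero n)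
      }
    ; ⁻¹-homo = λ x i → trans
        (sum-cong-≋ λ j → trans (sym (ℤ.neg-distribʳ-* (M i j) (x j)))
                                (sym (ℤ.-1*i≡-i (M i j ℤ.* x j))))
        (trans (sym (*-distribˡ-sum -1ℤ (λ j → M i j ℤ.* x j))) (ℤ.-1*i≡-i _))
    }

  coker : AbelianGroup 0ℓ 0ℓ
  coker = cokernel (ℤ^ n) (ℤ^ m) _*ᵥ_ *ᵥ-isGroupHomomorphism

-- Finite, connected (in particular nonempty), loopless multigraphs.
record Graph : Set where
  field
    order        : ℕ
    .{{nonempty}} : NonZero order
    edges        : Fin order → Fin order → ℕ
    symmetric    : ∀ u v → edges u v ≡ edges v u
    loopless     : ∀ v → edges v v ≡ 0
    connected    : ∀ u v → Star (λ x y → 0 < edges x y) u v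

  Vertex : Set
  Vertex = Fin order

record ArithmeticalStructure (G : Graph) : Set where
  open Graph G
  open Sum ℕ.+-*-semiring using (sum)
  field
    d           : Vertex → ℕ
    r           : Vertex → ℕ
    r-positive  : ∀ v → 0 < r v
    r-primitive : ∀ k → (∀ v → k ∣ r v) → k ≡ 1
    balanced    : ∀ v → r v * d v ≡ sum λ u → edges v u * r u

module _ (G : Graph) where
  open Graph G

  adjacency : Matrix order order
  adjacency u v = + edges u v

  laplacian : (Vertex → ℕ) → Matrix order order
  laplacian d u v = diag (λ w → + d w) u v ℤ.- adjacency u v

  criticalGroup : ArithmeticalStructure G → AbelianGroup 0ℓ 0ℓ
  criticalGroup s = torsionSubgroup (coker (laplacian (ArithmeticalStructure.d s)))

IsCriticalGroupOn : AbelianGroup 0ℓ 0ℓ → Graph → Set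
IsCriticalGroupOn A G = Σ[ s ∈ ArithmeticalStructure G ] criticalGroup G s ≅ A

-- n is the number of leaves; the central vertex is zero.
S : ℕ → Graph
S n = record
  { order     = suc n
  ; edges     = edges
  ; symmetric = λ { zero zero → refl ; zero (suc _) → refl
                  ; (suc _) zero → refl ; (suc _) (suc _) → refl }
  ; loopless  = λ { zero → refl ; (suc _) → refl }
  ; connected = λ { zero    zero    → ε
                  ; zero    (suc _) → z<s ◅ ε
                  ; (suc _) zero    → z<s ◅ ε
                  ; (suc _) (suc _) → _◅_ {j = zero} z<s (z<s ◅ ε) }
  }
  where
  edges : Fin (suc n) → Fin (suc n) → ℕ
  edges zero    zero    = 0
  edges zero    (suc _) = 1
  edges (suc _) zero    = 1
  edges (suc _) (suc _) = 0

K : (n : ℕ) .{{_ : NonZero n}} → Graph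
K n = record
  { order     = n
  ; edges     = edges
  ; symmetric = symmetric
  ; loopless  = loopless
  ; connected = connected
  }
  where
  edges : Fin n → Fin n → ℕ
  edges u v = if does (u ≟ v) then 0 else 1

  symmetric : ∀ u v → edges u v ≡ edges v u
  symmetric u v with u ≟ v | v ≟ u
  ... | yes _   | yes _   = refl
  ... | no  _   | no  _   = refl
  ... | yes u≡v | no  v≢u = contradiction (sym u≡v) v≢u
  ... | no  u≢v | yes v≡u = contradiction (sym v≡u) u≢v

  loopless : ∀ v → edges v v ≡ 0
  loopless v with v ≟ v
  ... | yes _   = refl
  ... | no  v≢v = contradiction refl v≢v

  adjacent : ∀ {u v} → Dec (u ≡ v) → Star (λ x y → 0 < edges x y) u v
  adjacent (yes refl) = ε
  adjacent {u} {v} (no u≢v) = edge ◅ ε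
    where
    edge : 0 < edges u v
    edge with u ≟ v
    ... | yes u≡v = contradiction u≡v u≢v
    ... | no  _   = z<s

  connected : ∀ u v → Star (λ x y → 0 < edges x y) u v
  connected u v = adjacent (u ≟ v)

{-# OPTIONS --safe #-}
module Submission where

-- An expansion 1 = Σ 1/Dᵢ with positive integers Dᵢ gives arithmetical
-- structures on K_n (with d = D − 1) and on S_n (with d = 1 at the centre and
-- d = D on the leaves), and for both the critical group is the torsion of the
-- group generated by e₁,…,eₙ subject to Dᵢ eᵢ = Σ eⱼ.
--
-- Let N = s₁⋯sₘ = s_{m+1} − 1, so that 1 = 1/s₁ + … + 1/sₘ + 1/N.  If N = M c,
-- then 1/N = 1/(c(M+1)) + 1/(N(M+1)), and replacing 1/N by these two terms gives
-- an expansion of 1 whose critical group is ℤ/c: the homomorphism to ℤ/c sends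
-- the two new generators to 1 and 0 and the generator of sᵢ to N/sᵢ.  Its
-- injectivity on torsion comes down to diag(s₁,…,sₘ) − J being unimodular.
-- Since each Sylvester number sₖ divides N once m ≥ k, a product of distinct
-- primes in 𝒮𝒫 divides N for m large.

open import Algebra.Bundles using (AbelianGroup)
import Algebra.Definitions.RawMonoid as RawMonoid
import Algebra.Properties.CommutativeSemigroup as CommutativeSemigroupProperties
import Algebra.Properties.Semiring.Sum as Sum
open import Data.Bool.Base using (if_then_else_)
open import Data.Bool.Properties using (if-float)
open import Data.Fin.Base using (Fin; zero; suc)
open import Data.Fin.Properties using (_≟_)
open import Data.Integer.Base using (ℤ; +_; 0ℤ; 1ℤ; -1ℤ; _+_; _*_; _-_; -_)
import Data.Integer.Properties as ℤ
open import Data.Integer.Tactic.RingSolver using (solve-∀)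
open import Data.List.Base using (List; []; _∷_)
open import Data.List.Membership.Propositional using (_∈_)
open import Data.List.Relation.Unary.All as All using (All; []; _∷_)
open import Data.List.Relation.Unary.AllPairs using ([]; _∷_)
open import Data.List.Relation.Unary.Any using (here; there)
open import Data.List.Relation.Unary.Unique.Propositional using (Unique)
open import Data.Nat.Base as ℕ using (ℕ; zero; suc; NonZero; _<_; z<s)
open import Data.Nat.Coprimality using (Coprime; coprime-divisor)
open import Data.Nat.Divisibility
  using (_∣_; divides; ∣-refl; ∣-trans; ∣1⇒≡1; 1∣_; m∣m*n; n∣m*n; *-monoʳ-∣)
open import Data.Nat.ListAction using (product)
open import Data.Nat.Primality
  using (Prime; prime⇒irreducible; euclidsLemma; ¬prime[1]; productOfPrimes≥1)
import Data.Nat.Properties as ℕ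
open import Data.Product.Base using (_×_; Σ-syntax; ∃-syntax; _,_; proj₁)
open import Data.Sum.Base using (inj₁; inj₂)
open import Function.Base using (_∘_)
open import Relation.Binary.PropositionalEquality
  using (_≡_; refl; sym; trans; cong; cong₂; subst; module ≡-Reasoning)
open import Relation.Nullary using (¬_; does; contradiction)
open import Defs

open Sum ℤ.+-*-semiring
  using (sum; sum-cong-≋; ∑-distrib-+; ∑-comm; *-distribˡ-sum; *-distribʳ-sum)
open Sum ℕ.+-*-semiring using () renaming (sum to sumℕ)
open CommutativeSemigroupProperties ℤ.*-commutativeSemigroup
  using () renaming (x∙yz≈y∙xz to *-swap)
open CommutativeSemigroupProperties ℕ.*-commutativeSemigroup
  using () renaming (x∙yz≈y∙xz to *ℕ-swap)
open ≡-Reasoning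

-- Dot products and finite sums over the integers.

infix 8 _·_

_·_ : ∀ {n} → (Fin n → ℤ) → (Fin n → ℤ) → ℤ
x · y = sum λ i → x i * y i

·-congʳ : ∀ {n} (x : Fin n → ℤ) {y z} → (∀ i → y i ≡ z i) → x · y ≡ x · z
·-congʳ x y≈z = sum-cong-≋ λ i → cong (x i *_) (y≈z i)

·-distribˡ-+ : ∀ {n} (x y z : Fin n → ℤ) → x · (λ i → y i + z i) ≡ x · y + x · z
·-distribˡ-+ x y z = trans
  (sum-cong-≋ λ i → ℤ.*-distribˡ-+ (x i) (y i) (z i))
  (∑-distrib-+ (λ i → x i * y i) (λ i → x i * z i))

·-*ʳ : ∀ {n} k (x y : Fin n → ℤ) → x · (λ i → k * y i) ≡ k * x · y
·-*ʳ k x y = trans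
  (sum-cong-≋ λ i → *-swap (x i) k (y i))
  (sym (*-distribˡ-sum k (λ i → x i * y i)))

·-*ˡ : ∀ {n} k (x y : Fin n → ℤ) → (λ i → k * x i) · y ≡ k * x · y
·-*ˡ k x y = trans
  (sum-cong-≋ λ i → ℤ.*-assoc k (x i) (y i))
  (sym (*-distribˡ-sum k (λ i → x i * y i)))

·-negʳ : ∀ {n} (x y : Fin n → ℤ) → x · (λ i → - y i) ≡ - (x · y)
·-negʳ x y = begin
  x · (λ i → - y i)           ≡⟨ ·-congʳ x (λ i → ℤ.-1*i≡-i (y i)) ⟨
  x · (λ i → -1ℤ * y i)     ≡⟨ ·-*ʳ -1ℤ x y ⟩
  -1ℤ * x · y               ≡⟨ ℤ.-1*i≡-i (x · y) ⟩
  - (x · y)                   ∎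

·-distribˡ-- : ∀ {n} (x y z : Fin n → ℤ) → x · (λ i → y i - z i) ≡ x · y - x · z
·-distribˡ-- x y z = trans (·-distribˡ-+ x y (λ i → - z i)) (cong (_+_ (x · y)) (·-negʳ x z))

·-zeroˡ : ∀ {n} (x y : Fin n → ℤ) → (∀ i → x i ≡ 0ℤ) → x · y ≡ 0ℤ
·-zeroˡ x y x≈0 = begin
  x · y              ≡⟨ sum-cong-≋ (λ i → cong (_* y i) (x≈0 i)) ⟩
  (λ _ → 0ℤ * 0ℤ) · y ≡⟨ ·-*ˡ 0ℤ (λ _ → 0ℤ) y ⟩
  0ℤ                 ∎

·-zeroʳ : ∀ {n} (x : Fin n → ℤ) → x · (λ _ → 0ℤ) ≡ 0ℤ
·-zeroʳ x = ·-*ʳ 0ℤ x (λ _ → 0ℤ)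

-- Exchanging the two summations moves `M` across the dot product, and symmetry absorbs the
-- transpose. Functionals can thus be evaluated on the image of a Laplacian.
*ᵥ-adjoint : ∀ {n} (M : Matrix n n) → (∀ i j → M i j ≡ M j i) →
             ∀ x y → x · (M *ᵥ y) ≡ (M *ᵥ x) · y
*ᵥ-adjoint M M-sym x y = begin
  (sum λ i → x i * M i · y)                 ≡⟨ sum-cong-≋ (λ i → *-distribˡ-sum (x i) (λ j → M i j * y j)) ⟩
  (sum λ i → sum λ j → x i * (M i j * y j))  ≡⟨ ∑-comm (λ i j → x i * (M i j * y j)) ⟩
  (sum λ j → sum λ i → x i * (M i j * y j))  ≡⟨ sum-cong-≋ (λ j → sum-cong-≋ λ i → transpose j i) ⟩
  (sum λ j → sum λ i → M j i * x i * y j)    ≡⟨ sum-cong-≋ (λ j → *-distribʳ-sum (y j) (λ i → M j i * x i)) ⟨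
  (sum λ j → M j · x * y j)                 ∎
  where
  rearrange : ∀ a b c → a * (b * c) ≡ b * a * c
  rearrange = solve-∀

  transpose : ∀ j i → x i * (M i j * y j) ≡ M j i * x i * y j
  transpose j i = trans (rearrange (x i) (M i j) (y j)) (cong (λ m → m * x i * y j) (M-sym i j))

+-sum : ∀ {n} (f : Fin n → ℕ) → + sumℕ f ≡ sum (λ i → + f i)
+-sum {zero}  f = refl
+-sum {suc n} f = trans (ℤ.pos-+ (f zero) _) (cong (_+_ (+ f zero)) (+-sum (f ∘ suc)))

-- The coefficient is `b` everywhere, corrected by `a - b` at `v`. The case `b = 0` serves diagonal
-- matrices; `a = 0`, `b = 1` serves the adjacency of a complete graph.
sum-if : ∀ {n} (v : Fin n) (a b : ℤ) x →
         (sum λ u → (if does (v ≟ u) then a else b) * x u) ≡ (a - b) * x v + b * sum x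
sum-if zero a b x = trans
  (cong (_+_ (a * x zero)) (sym (*-distribˡ-sum b (x ∘ suc))))
  (identity a b (x zero) (sum (x ∘ suc)))
  where
  identity : ∀ a b x s → a * x + b * s ≡ (a - b) * x + b * (x + s)
  identity = solve-∀
sum-if (suc v) a b x = trans
  (cong (_+_ (b * x zero)) (sum-if v a b (x ∘ suc)))
  (identity ((a - b) * x (suc v)) b (x zero) (sum (x ∘ suc)))
  where
  identity : ∀ p b x s → b * x + (p + b * s) ≡ p + b * (x + s)
  identity = solve-∀

diag-symmetric : ∀ {n} (d : Fin n → ℤ) i j → diag d i j ≡ diag d j i
diag-symmetric d zero    zero    = refl
diag-symmetric d zero    (suc j) = refl
diag-symmetric d (suc i) zero    = refl
diag-symmetric d (suc i) (suc j) = diag-symmetric (d ∘ suc) i j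

-- Graph Laplacians and a criterion for a cyclic critical group.

-- When f is symmetric with f r = 0, the functional φ induces an isomorphism
-- from the torsion of the cokernel of f onto ℤ/c, with inverse 1 ↦ τ.
record Cyclic (c : ℕ) {n} (f : (Fin n → ℤ) → (Fin n → ℤ)) (r : Fin n → ℤ) : Set where
  field
    φ τ   : Fin n → ℤ
    fφ≈cτ : ∀ i → f φ i ≡ + c * τ i
    φ·τ≡1 : φ · τ ≡ 1ℤ
    solve : ∀ w → r · w ≡ 0ℤ → φ · w ≡ 0ℤ → ∃[ α ] (∀ i → f α i ≡ w i)

module _ (G : Graph) where
  open Graph G

  laplacian-*ᵥ : ∀ d x v → (laplacian G d *ᵥ x) v ≡
                 + d v * x v - sum λ u → + edges v u * x u
  laplacian-*ᵥ d x v = begin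
    (sum λ u → (diag (+_ ∘ d) v u - + edges v u) * x u)
      ≡⟨ sum-cong-≋ (λ u → distrib (diag (+_ ∘ d) v u) (+ edges v u) (x u)) ⟩
    (sum λ u → diag (+_ ∘ d) v u * x u + - 1ℤ * (+ edges v u * x u))
      ≡⟨ ∑-distrib-+ (λ u → diag (+_ ∘ d) v u * x u) (λ u → - 1ℤ * (+ edges v u * x u)) ⟩
    (sum λ u → diag (+_ ∘ d) v u * x u) + (sum λ u → - 1ℤ * (+ edges v u * x u))
      ≡⟨ cong₂ _+_ (sum-if v (+ d v) 0ℤ x) (sym (*-distribˡ-sum (- 1ℤ) (λ u → + edges v u * x u))) ⟩
    (+ d v - 0ℤ) * x v + 0ℤ * sum x + - 1ℤ * (sum λ u → + edges v u * x u)
      ≡⟨ identity (+ d v) (x v) (sum x) _ ⟩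
    + d v * x v - (sum λ u → + edges v u * x u) ∎
    where
    distrib : ∀ a b c → (a - b) * c ≡ a * c + - 1ℤ * (b * c)
    distrib = solve-∀

    identity : ∀ a b c e → (a - 0ℤ) * b + 0ℤ * c + - 1ℤ * e ≡ a * b - e
    identity = solve-∀

  laplacian-symmetric : ∀ d u v → laplacian G d u v ≡ laplacian G d v u
  laplacian-symmetric d u v =
    cong₂ _-_ (diag-symmetric (+_ ∘ d) u v) (cong +_ (symmetric u v))

  pos-∑edges : ∀ (r : Vertex → ℕ) v → + (sumℕ λ u → edges v u ℕ.* r u) ≡ sum λ u → + edges v u * + r u
  pos-∑edges r v = trans (+-sum (λ u → edges v u ℕ.* r u)) (sum-cong-≋ λ u → ℤ.pos-* (edges v u) (r u))

  -- The balance condition is `L r = 0` read row by row, so arithmetical structures can be obtained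
  -- from identities over the integers.
  kernel⇒balanced : ∀ d r → (∀ v → (laplacian G d *ᵥ (+_ ∘ r)) v ≡ 0ℤ) →
                    ∀ v → r v ℕ.* d v ≡ sumℕ λ u → edges v u ℕ.* r u
  kernel⇒balanced d r Lr≈0 v = ℤ.+-injective (begin
    + (r v ℕ.* d v)                      ≡⟨ cong +_ (ℕ.*-comm (r v) (d v)) ⟩
    + (d v ℕ.* r v)                      ≡⟨ ℤ.pos-* (d v) (r v) ⟩
    + d v * + r v                        ≡⟨ ℤ.i-j≡0⇒i≡j _ _ (trans (sym (laplacian-*ᵥ d (+_ ∘ r) v)) (Lr≈0 v)) ⟩
    (sum λ u → + edges v u * + r u)      ≡⟨ pos-∑edges r v ⟨
    + (sumℕ λ u → edges v u ℕ.* r u)     ∎)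

  module _ (s : ArithmeticalStructure G) where
    open ArithmeticalStructure s

    balanced⇒kernel : ∀ v → (laplacian G d *ᵥ (+_ ∘ r)) v ≡ 0ℤ
    balanced⇒kernel v = trans (laplacian-*ᵥ d (+_ ∘ r) v) (ℤ.i≡j⇒i-j≡0 (begin
      + d v * + r v                        ≡⟨ ℤ.pos-* (d v) (r v) ⟨
      + (d v ℕ.* r v)                      ≡⟨ cong +_ (ℕ.*-comm (d v) (r v)) ⟩
      + (r v ℕ.* d v)                      ≡⟨ cong +_ (balanced v) ⟩
      + (sumℕ λ u → edges v u ℕ.* r u)     ≡⟨ pos-∑edges r v ⟩
      (sum λ u → + edges v u * + r u)      ∎))

    private
      L = laplacian G d
      open RawMonoid (AbelianGroup.rawMonoid (coker L)) using () renaming (_×_ to _•_)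

      •≗* : ∀ k x v → (k • x) v ≡ + k * x v
      •≗* zero    x v = refl
      •≗* (suc k) x v = begin
        x v + (k • x) v    ≡⟨ cong (_+_ (x v)) (•≗* k x v) ⟩
        x v + + k * x v    ≡⟨ ℤ.suc-* (+ k) (x v) ⟨
        + suc k * x v      ∎

      adjoint : ∀ x y → x · (L *ᵥ y) ≡ (L *ᵥ x) · y
      adjoint = *ᵥ-adjoint L (laplacian-symmetric d)

      r·L≡0 : ∀ z → (+_ ∘ r) · (L *ᵥ z) ≡ 0ℤ
      r·L≡0 z = trans (adjoint (+_ ∘ r) z) (·-zeroˡ _ z balanced⇒kernel)

      -- If `k w = L z` then `k (r · w) = r · L z = 0`, and the positive `k` cancels.
      r·torsion≡0 : ∀ w → IsTorsion (coker L) w → (+_ ∘ r) · w ≡ 0ℤ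
      r·torsion≡0 w (k@(suc _) , _ , z , kw≈Lz) = ℤ.*-cancelˡ-≡ (+ k) _ _ (begin
        + k * (+_ ∘ r) · w               ≡⟨ ·-*ʳ (+ k) (+_ ∘ r) w ⟨
        (+_ ∘ r) · (λ i → + k * w i)     ≡⟨ ·-congʳ (+_ ∘ r) (λ i → •≗* k w i) ⟨
        (+_ ∘ r) · (k • w)               ≡⟨ ·-congʳ (+_ ∘ r) (λ i → ℤ.+-identityʳ ((k • w) i)) ⟨
        (+_ ∘ r) · (λ i → (k • w) i - 0ℤ) ≡⟨ ·-congʳ (+_ ∘ r) kw≈Lz ⟩
        (+_ ∘ r) · (L *ᵥ z)              ≡⟨ r·L≡0 z ⟩
        0ℤ                               ≡⟨ ℤ.*-zeroʳ (+ k) ⟨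
        + k * 0ℤ                         ∎)

    -- The isomorphism is `w ↦ φ · w`. It is well defined because `φ · L z = L φ · z = c (τ · z)`.
    -- It is surjective because `k τ` has value `k` and is torsion, as `c (k τ) = L (k φ)`.
    -- Injectivity is where `solve` enters.
    cyclic⇒criticalGroup≅ℤ/ : ∀ {c} → 0 < c → Cyclic c (L *ᵥ_) (+_ ∘ r) → criticalGroup G s ≅ ℤ/ c
    cyclic⇒criticalGroup≅ℤ/ {c} 0<c cyc = (λ (w , _) → φ · w) , record
      { isGroupMonomorphism = record
        { isGroupHomomorphism = record
          { isMonoidHomomorphism = record
            { isMagmaHomomorphism = record
              { isRelHomomorphism = record { cong = λ { {x} {y} → φ-cong x y } }
              ; homo = λ x y → ≡⇒≈ (·-distribˡ-+ φ (proj₁ x) (proj₁ y))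
              }
            ; ε-homo = ≡⇒≈ (·-zeroʳ φ)
            }
          ; ⁻¹-homo = λ x → ≡⇒≈ (·-negʳ φ (proj₁ x))
          }
        ; injective = λ { {x} {y} → φ-injective x y }
        }
      ; surjective = λ k → multiple k , λ {w} w≈kτ →
          C.trans {φ · proj₁ w} {φ · proj₁ (multiple k)} {k} (φ-cong w (multiple k) w≈kτ) (≡⇒≈ (φ-multiple k))
      }
      where
      open Cyclic cyc
      module T = AbelianGroup (criticalGroup G s)
      module C = AbelianGroup (ℤ/ c)

      ≡⇒≈ : ∀ {x y} → x ≡ y → x C.≈ y
      ≡⇒≈ x≡y = C.reflexive x≡y

      φ-cong : ∀ x y → x T.≈ y → φ · proj₁ x C.≈ φ · proj₁ y
      φ-cong (x , _) (y , _) (z , x-y≈Lz) = τ · z , (begin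
        φ · x - φ · y              ≡⟨ ·-distribˡ-- φ x y ⟨
        φ · (λ i → x i - y i)      ≡⟨ ·-congʳ φ x-y≈Lz ⟩
        φ · (L *ᵥ z)               ≡⟨ adjoint φ z ⟩
        (L *ᵥ φ) · z               ≡⟨ sum-cong-≋ (λ i → cong (_* z i) (fφ≈cτ i)) ⟩
        (λ i → + c * τ i) · z      ≡⟨ ·-*ˡ (+ c) τ z ⟩
        + c * τ · z                ∎)

      φ-injective : ∀ x y → φ · proj₁ x C.≈ φ · proj₁ y → x T.≈ y
      φ-injective (x , x-tor) (y , y-tor) (k , φx-φy≡ck) =
        let α , Lα≈w = solve w r·w≡0 φ·w≡0
        in (λ i → α i + k * φ i) , λ i → begin
          x i - y i                                ≡⟨ split (x i - y i) (k * (+ c * τ i)) ⟩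
          w i + k * (+ c * τ i)                    ≡⟨ cong₂ _+_ (Lα≈w i) (cong (k *_) (fφ≈cτ i)) ⟨
          (L *ᵥ α) i + k * (L *ᵥ φ) i              ≡⟨ cong (_+_ ((L *ᵥ α) i)) (·-*ʳ k (L i) φ) ⟨
          (L *ᵥ α) i + (L *ᵥ λ j → k * φ j) i      ≡⟨ ·-distribˡ-+ (L i) α (λ j → k * φ j) ⟨
          (L *ᵥ λ j → α j + k * φ j) i             ∎
        where
        -- The values of `x` and `y` differ by `c k`, and `L φ = c τ` has value `c`. Removing `k`
        -- copies of it from `x - y` leaves a vector killed by both `φ` and `r`; if `α` solves for
        -- that vector, `α + k φ` is a preimage of `x - y`.
        w : Vertex → ℤ
        w i = x i - y i - k * (+ c * τ i)

        split : ∀ a b → a ≡ a - b + b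
        split = solve-∀

        ·w : ∀ ψ → ψ · w ≡ ψ · x - ψ · y - k * ψ · (λ i → + c * τ i)
        ·w ψ = trans (·-distribˡ-- ψ (λ i → x i - y i) (λ i → k * (+ c * τ i)))
                     (cong₂ _-_ (·-distribˡ-- ψ x y) (·-*ʳ k ψ (λ i → + c * τ i)))

        r·w≡0 : (+_ ∘ r) · w ≡ 0ℤ
        r·w≡0 = begin
          (+_ ∘ r) · w
            ≡⟨ ·w (+_ ∘ r) ⟩
          (+_ ∘ r) · x - (+_ ∘ r) · y - k * (+_ ∘ r) · (λ i → + c * τ i)
            ≡⟨ cong₂ (λ a b → a - b - k * (+_ ∘ r) · (λ i → + c * τ i))
                     (r·torsion≡0 x x-tor) (r·torsion≡0 y y-tor) ⟩
          0ℤ - 0ℤ - k * (+_ ∘ r) · (λ i → + c * τ i)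
            ≡⟨ cong (λ a → 0ℤ - 0ℤ - k * a) (trans (sym (·-congʳ (+_ ∘ r) fφ≈cτ)) (r·L≡0 φ)) ⟩
          0ℤ - 0ℤ - k * 0ℤ
            ≡⟨ vanish k ⟩
          0ℤ ∎
          where
          vanish : ∀ k → 0ℤ - 0ℤ - k * 0ℤ ≡ 0ℤ
          vanish = solve-∀

        φ·w≡0 : φ · w ≡ 0ℤ
        φ·w≡0 = begin
          φ · w                                           ≡⟨ ·w φ ⟩
          φ · x - φ · y - k * φ · (λ i → + c * τ i)       ≡⟨ cong₂ (λ a b → a - k * b) φx-φy≡ck (·-*ʳ (+ c) φ τ) ⟩
          + c * k - k * (+ c * φ · τ)                     ≡⟨ cong (λ a → + c * k - k * (+ c * a)) φ·τ≡1 ⟩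
          + c * k - k * (+ c * 1ℤ)                        ≡⟨ vanish (+ c) k ⟩
          0ℤ                                              ∎
          where
          vanish : ∀ c k → c * k - k * (c * 1ℤ) ≡ 0ℤ
          vanish = solve-∀

      multiple : ℤ → T.Carrier
      multiple k = (λ i → k * τ i) , c , 0<c , (λ i → k * φ i) , λ i → begin
        (c • (λ j → k * τ j)) i - 0ℤ     ≡⟨ ℤ.+-identityʳ _ ⟩
        (c • (λ j → k * τ j)) i          ≡⟨ •≗* c _ i ⟩
        + c * (k * τ i)                  ≡⟨ *-swap (+ c) k (τ i) ⟩
        k * (+ c * τ i)                  ≡⟨ cong (k *_) (fφ≈cτ i) ⟨
        k * (L *ᵥ φ) i                   ≡⟨ ·-*ʳ k (L i) φ ⟨
        (L *ᵥ λ j → k * φ j) i           ∎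

      φ-multiple : ∀ k → φ · proj₁ (multiple k) ≡ k
      φ-multiple k = trans (·-*ʳ k φ τ) (trans (cong (k *_) φ·τ≡1) (ℤ.*-identityʳ k))

-- Arithmetical structures on complete graphs and stars from unit fractions.

-- diag(D) − J, where J is the all-ones matrix.
diag-J : ∀ {n} → (Fin n → ℕ) → (Fin n → ℤ) → (Fin n → ℤ)
diag-J D x i = + D i * x i - sum x

K-edges : ∀ n .{{_ : NonZero n}} x v →
          (sum λ u → + Graph.edges (K n) v u * x u) ≡ sum x - x v
K-edges n x v = begin
  (sum λ u → + (if does (v ≟ u) then 0 else 1) * x u)
    ≡⟨ sum-cong-≋ (λ u → cong (_* x u) (if-float +_ (does (v ≟ u)))) ⟩
  (sum λ u → (if does (v ≟ u) then 0ℤ else 1ℤ) * x u)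
    ≡⟨ sum-if v 0ℤ 1ℤ x ⟩
  (0ℤ - 1ℤ) * x v + 1ℤ * sum x
    ≡⟨ identity (x v) (sum x) ⟩
  sum x - x v ∎
  where
  identity : ∀ a b → (0ℤ - 1ℤ) * a + 1ℤ * b ≡ b - a
  identity = solve-∀

sum-0* : ∀ {n} (x : Fin n → ℤ) → (sum λ i → 0ℤ * x i) ≡ 0ℤ
sum-0* x = sym (*-distribˡ-sum 0ℤ x)

sum-1* : ∀ {n} (x : Fin n → ℤ) → (sum λ i → 1ℤ * x i) ≡ sum x
sum-1* x = sum-cong-≋ λ i → ℤ.*-identityˡ (x i)

infixr 5 _▹_
_▹_ : ∀ {a} {A : Set a} {n} → A → (Fin n → A) → (Fin (suc n) → A)
(x ▹ xs) zero    = x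
(x ▹ xs) (suc i) = xs i

-- The two maps agree only pointwise, so the data are transported field by field, with the same `φ`
-- and `τ`.
cyclic-resp : ∀ {c n f g} {r : Fin n → ℤ} → (∀ x i → f x i ≡ g x i) → Cyclic c f r → Cyclic c g r
cyclic-resp f≈g cyc = record
  { φ     = φ
  ; τ     = τ
  ; fφ≈cτ = λ i → trans (sym (f≈g φ i)) (fφ≈cτ i)
  ; φ·τ≡1 = φ·τ≡1
  ; solve = λ w r·w≡0 φ·w≡0 →
      let α , fα≈w = solve w r·w≡0 φ·w≡0 in α , λ i → trans (sym (f≈g α i)) (fα≈w i)
  }
  where open Cyclic cyc

-- The condition on r says that the D i are the denominators of an Egyptian
-- fraction expansion of 1.
module _ {n} {c : ℕ} (0<c : 0 < c) (D r : Fin (suc n) → ℕ)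
         (D-positive : ∀ i → 0 < D i) (r-positive : ∀ i → 0 < r i)
         (r-primitive : ∀ k → (∀ i → k ∣ r i) → k ≡ 1)
         (diag-J-r≈0 : ∀ i → diag-J D (+_ ∘ r) i ≡ 0ℤ)
         (cyc : Cyclic c (diag-J D) (+_ ∘ r)) where

  private
    open Cyclic cyc

    -- Row `i` of the Laplacian of the complete graph is `(d i + 1) x i - sum x`, hence the shift by
    -- one; `pred` is exact because `D i` is positive.
    dᴷ : Fin (suc n) → ℕ
    dᴷ = ℕ.pred ∘ D

    Lᴷ : ∀ x i → (laplacian (K (suc n)) dᴷ *ᵥ x) i ≡ diag-J D x i
    Lᴷ x i = begin
      (laplacian (K (suc n)) dᴷ *ᵥ x) i
        ≡⟨ laplacian-*ᵥ (K (suc n)) dᴷ x i ⟩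
      + dᴷ i * x i - (sum λ j → + Graph.edges (K (suc n)) i j * x j)
        ≡⟨ cong (_-_ (+ dᴷ i * x i)) (K-edges (suc n) x i) ⟩
      + dᴷ i * x i - (sum x - x i)
        ≡⟨ identity (+ dᴷ i) (x i) (sum x) ⟩
      (1ℤ + + dᴷ i) * x i - sum x
        ≡⟨ cong (λ e → + e * x i - sum x) (ℕ.suc-pred (D i) {{ℕ.>-nonZero (D-positive i)}}) ⟩
      + D i * x i - sum x ∎
      where
      identity : ∀ d x s → d * x - (s - x) ≡ (1ℤ + d) * x - s
      identity = solve-∀

    structureᴷ : ArithmeticalStructure (K (suc n))
    structureᴷ = record
      { d           = dᴷ
      ; r           = r
      ; r-positive  = r-positive
      ; r-primitive = r-primitive
      ; balanced    = kernel⇒balanced (K (suc n)) dᴷ r λ i → trans (Lᴷ (+_ ∘ r) i) (diag-J-r≈0 i)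
      }

    -- Balance at a centre with `d = 1` forces its label to be the sum of the leaf labels. Balance
    -- at leaf `i` is then row `i` of `diag-J D`.
    dˢ rˢ : Fin (suc (suc n)) → ℕ
    dˢ = 1 ▹ D
    rˢ = sumℕ r ▹ r

    fˢ : (Fin (suc (suc n)) → ℤ) → (Fin (suc (suc n)) → ℤ)
    fˢ x = (x zero - sum (x ∘ suc)) ▹ λ i → + D i * x (suc i) - x zero

    Lˢ : ∀ x i → (laplacian (S (suc n)) dˢ *ᵥ x) i ≡ fˢ x i
    Lˢ x zero = begin
      (laplacian (S (suc n)) dˢ *ᵥ x) zero
        ≡⟨ laplacian-*ᵥ (S (suc n)) dˢ x zero ⟩
      1ℤ * x zero - (0ℤ * x zero + sum λ i → 1ℤ * x (suc i))
        ≡⟨ cong (λ a → 1ℤ * x zero - (0ℤ * x zero + a)) (sum-1* (x ∘ suc)) ⟩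
      1ℤ * x zero - (0ℤ * x zero + sum (x ∘ suc))
        ≡⟨ identity (x zero) (sum (x ∘ suc)) ⟩
      x zero - sum (x ∘ suc) ∎
      where
      identity : ∀ a s → 1ℤ * a - (0ℤ * a + s) ≡ a - s
      identity = solve-∀
    Lˢ x (suc i) = begin
      (laplacian (S (suc n)) dˢ *ᵥ x) (suc i)
        ≡⟨ laplacian-*ᵥ (S (suc n)) dˢ x (suc i) ⟩
      + D i * x (suc i) - (1ℤ * x zero + sum λ j → 0ℤ * x (suc j))
        ≡⟨ cong (λ a → + D i * x (suc i) - (1ℤ * x zero + a)) (sum-0* (x ∘ suc)) ⟩
      + D i * x (suc i) - (1ℤ * x zero + 0ℤ)
        ≡⟨ identity (+ D i * x (suc i)) (x zero) ⟩
      + D i * x (suc i) - x zero ∎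
      where
      identity : ∀ a b → a - (1ℤ * b + 0ℤ) ≡ a - b
      identity = solve-∀

    +sum-r : + sumℕ r ≡ sum (+_ ∘ r)
    +sum-r = +-sum r

    fˢr≈0 : ∀ i → fˢ (+_ ∘ rˢ) i ≡ 0ℤ
    fˢr≈0 zero    = ℤ.i≡j⇒i-j≡0 +sum-r
    fˢr≈0 (suc i) = trans (cong (_-_ (+ D i * + r i)) +sum-r) (diag-J-r≈0 i)

    sum-r-positive : 0 < sumℕ r
    sum-r-positive = ℕ.<-≤-trans (r-positive zero) (ℕ.m≤m+n (r zero) _)

    structureˢ : ArithmeticalStructure (S (suc n))
    structureˢ = record
      { d           = dˢ
      ; r           = rˢ
      ; r-positive  = λ { zero → sum-r-positive ; (suc i) → r-positive i }
      ; r-primitive = λ k k∣r → r-primitive k (k∣r ∘ suc)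
      ; balanced    = kernel⇒balanced (S (suc n)) dˢ rˢ λ i → trans (Lˢ (+_ ∘ rˢ) i) (fˢr≈0 i)
      }

    -- The relation at the centre is e₀ = Σ eᵢ, so the centre is eliminated:
    -- φ extends by Σ φ, and τ needs no component there.
    cyclicˢ : Cyclic c fˢ (+_ ∘ rˢ)
    cyclicˢ = record
      { φ     = sum φ ▹ φ
      ; τ     = 0ℤ ▹ τ
      ; fφ≈cτ = λ { zero → trans (ℤ.+-inverseʳ (sum φ)) (sym (ℤ.*-zeroʳ (+ c))) ; (suc i) → fφ≈cτ i }
      ; φ·τ≡1 = trans (cong (_+ φ · τ) (ℤ.*-zeroʳ (sum φ))) (trans (ℤ.+-identityˡ _) φ·τ≡1)
      ; solve = solveˢ
      }
      where
      -- Substituting `e₀ = Σ eᵢ` adds `w zero` to every leaf component. Taken with `ψ = r` and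
      -- `ψ = φ`, this carries both hypotheses on `w` over to the leaves.
      shift : ∀ ψ (w : Fin (suc (suc n)) → ℤ) →
              ψ · (λ i → w (suc i) + w zero) ≡ sum ψ * w zero + ψ · (w ∘ suc)
      shift ψ w = begin
        ψ · (λ i → w (suc i) + w zero)            ≡⟨ ·-distribˡ-+ ψ (w ∘ suc) (λ _ → w zero) ⟩
        ψ · (w ∘ suc) + (sum λ i → ψ i * w zero)  ≡⟨ cong (_+_ (ψ · (w ∘ suc))) (*-distribʳ-sum (w zero) ψ) ⟨
        ψ · (w ∘ suc) + sum ψ * w zero            ≡⟨ ℤ.+-comm (ψ · (w ∘ suc)) _ ⟩
        sum ψ * w zero + ψ · (w ∘ suc)            ∎

      solveˢ : ∀ w → (+_ ∘ rˢ) · w ≡ 0ℤ → (sum φ ▹ φ) · w ≡ 0ℤ → ∃[ α ] (∀ i → fˢ α i ≡ w i)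
      solveˢ w r·w≡0 φ·w≡0
        with α , fα≈w ← solve (λ i → w (suc i) + w zero)
               (trans (shift (+_ ∘ r) w)
                 (trans (cong (λ a → a * w zero + (+_ ∘ r) · (w ∘ suc)) (sym +sum-r)) r·w≡0))
               (trans (shift φ w) φ·w≡0)
        -- The row at the centre, `x₀ - sum x = w₀`, forces the first component.
        = (sum α + w zero) ▹ α , λ
          { zero    → cancel₀ (sum α) (w zero)
          ; (suc i) → begin
              + D i * α i - (sum α + w zero)  ≡⟨ regroup (+ D i * α i) (sum α) (w zero) ⟩
              diag-J D α i - w zero           ≡⟨ cong (_- w zero) (fα≈w i) ⟩
              w (suc i) + w zero - w zero     ≡⟨ cancel (w (suc i)) (w zero) ⟩
              w (suc i)                       ∎
          }
        where
        cancel₀ : ∀ a b → a + b - a ≡ b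
        cancel₀ = solve-∀

        regroup : ∀ a b c → a - (b + c) ≡ a - b - c
        regroup = solve-∀

        cancel : ∀ a b → a + b - b ≡ a
        cancel = solve-∀

  egyptian⇒onStar : IsCriticalGroupOn (ℤ/ c) (S (suc n))
  egyptian⇒onStar = structureˢ ,
    cyclic⇒criticalGroup≅ℤ/ (S (suc n)) structureˢ 0<c
      (cyclic-resp (λ x i → sym (Lˢ x i)) cyclicˢ)

  egyptian⇒onComplete : IsCriticalGroupOn (ℤ/ c) (K (suc n))
  egyptian⇒onComplete = structureᴷ ,
    cyclic⇒criticalGroup≅ℤ/ (K (suc n)) structureᴷ 0<c
      (cyclic-resp (λ x i → sym (Lᴷ x i)) cyc)

-- Sylvester's sequence, its partial products and its unit fractions.

sylvester-product : ℕ → ℕ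
sylvester-product zero    = 1
sylvester-product (suc m) = sylvester m ℕ.* sylvester-product m

-- With `s = N + 1`, the square is `s + s N`, so the truncated subtraction leaves exactly `s N`, the
-- next product.
sylvester≡1+product : ∀ m → sylvester m ≡ suc (sylvester-product m)
sylvester≡1+product zero = refl
sylvester≡1+product (suc m) with sylvester m | sylvester≡1+product m
... | _ | refl = trans (cong (λ a → a ℕ.∸ suc N ℕ.+ 1) (square N))
                       (trans (cong (ℕ._+ 1) (ℕ.m+n∸m≡n (suc N) (suc N ℕ.* N))) (ℕ.+-comm _ 1))
  where
  N = sylvester-product m

  square : ∀ N → suc N ℕ.^ 2 ≡ suc N ℕ.+ suc N ℕ.* N
  square N = trans (cong (suc N ℕ.*_) (ℕ.*-identityʳ (suc N))) (ℕ.*-suc (suc N) N)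

sylvester-positive : ∀ m → 0 < sylvester m
sylvester-positive m = subst (0 <_) (sym (sylvester≡1+product m)) z<s

sylvester-product-positive : ∀ m → 0 < sylvester-product m
sylvester-product-positive zero    = z<s
sylvester-product-positive (suc m) = ℕ.*-mono-< (sylvester-positive m) (sylvester-product-positive m)

+sylvester : ∀ m → + sylvester m ≡ 1ℤ + + sylvester-product m
+sylvester m = cong +_ (sylvester≡1+product m)

-- Listed from the largest term down, so that induction on `m` removes the head.
sylvesters : ∀ m → Fin m → ℕ
sylvesters (suc m) = sylvester m ▹ sylvesters m

-- The quotients N/sᵢ, where N = s₁⋯sₘ, built recursively to avoid division.
cofactors : ∀ m → Fin m → ℕ
cofactors (suc m) = sylvester-product m ▹ λ i → sylvester m ℕ.* cofactors m i

sylvesters-positive : ∀ m i → 0 < sylvesters m i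
sylvesters-positive (suc m) zero    = sylvester-positive m
sylvesters-positive (suc m) (suc i) = sylvesters-positive m i

cofactors-positive : ∀ m i → 0 < cofactors m i
cofactors-positive (suc m) zero    = sylvester-product-positive m
cofactors-positive (suc m) (suc i) = ℕ.*-mono-< (sylvester-positive m) (cofactors-positive m i)

sylvesters*cofactors : ∀ m i → sylvesters m i ℕ.* cofactors m i ≡ sylvester-product m
sylvesters*cofactors (suc m) zero    = refl
sylvesters*cofactors (suc m) (suc i) = trans
  (*ℕ-swap (sylvesters m i) (sylvester m) (cofactors m i))
  (cong (sylvester m ℕ.*_) (sylvesters*cofactors m i))

cofactorsℤ : ∀ m → Fin m → ℤ
cofactorsℤ m i = + cofactors m i

cofactorsℤ-suc : ∀ m i → cofactorsℤ (suc m) (suc i) ≡ + sylvester m * cofactorsℤ m i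
cofactorsℤ-suc m i = ℤ.pos-* (sylvester m) (cofactors m i)

-- Sylvester's identity Σ 1/sᵢ + 1/∏sᵢ = 1, cleared of denominators.
sum-cofactors : ∀ m → 1ℤ + sum (cofactorsℤ m) ≡ + sylvester-product m
sum-cofactors zero    = refl
sum-cofactors (suc m) = begin
  1ℤ + (N + sum (cofactorsℤ (suc m) ∘ suc))
    ≡⟨ cong (λ a → 1ℤ + (N + a)) (sum-cong-≋ (cofactorsℤ-suc m)) ⟩
  1ℤ + (N + sum λ i → + sylvester m * cofactorsℤ m i)
    ≡⟨ cong (λ a → 1ℤ + (N + a)) (*-distribˡ-sum (+ sylvester m) (cofactorsℤ m)) ⟨
  1ℤ + (N + + sylvester m * A)
    -- Since N = 1 + A and the new term is N + 1 = 2 + A, only a polynomial identity in A remains.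
    ≡⟨ cong₂ (λ s n → 1ℤ + (n + s * A)) s≡2+A (sym N≡1+A) ⟩
  1ℤ + (1ℤ + A + (1ℤ + (1ℤ + A)) * A)
    ≡⟨ identity A ⟩
  (1ℤ + (1ℤ + A)) * (1ℤ + A)
    ≡⟨ cong₂ _*_ (sym s≡2+A) N≡1+A ⟩
  + sylvester m * N
    ≡⟨ ℤ.pos-* (sylvester m) (sylvester-product m) ⟨
  + sylvester-product (suc m) ∎
  where
  N = + sylvester-product m
  A = sum (cofactorsℤ m)

  N≡1+A : 1ℤ + A ≡ N
  N≡1+A = sum-cofactors m

  s≡2+A : + sylvester m ≡ 1ℤ + (1ℤ + A)
  s≡2+A = trans (+sylvester m) (cong (_+_ 1ℤ) (sym N≡1+A))

  identity : ∀ a → 1ℤ + (1ℤ + a + (1ℤ + (1ℤ + a)) * a) ≡ (1ℤ + (1ℤ + a)) * (1ℤ + a)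
  identity = solve-∀

-- diag(s₁,…,sₘ) − J is unimodular: its determinant is ∏sᵢ (1 − Σ 1/sᵢ) = 1.
sylvester-solve : ∀ m w → ∃[ α ] ((∀ i → diag-J (sylvesters m) α i ≡ w i) ×
                                  sum α ≡ cofactorsℤ m · w)
sylvester-solve zero    w = (λ ()) , (λ ()) , refl
sylvester-solve (suc m) w
  -- If β is the new component, the old rows form the smaller system with β added to the right-hand
  -- side. The statement about `sum α`, carried through the induction, gives `sum α = T + A β`. The
  -- first row becomes `(s - 1 - A) β - T = w₀`; as s = 2 + A, the coefficient of β is 1, so β = w₀
  -- + T is integral.
  with α , Hα≈w′ , sum-α ← sylvester-solve m (λ i → w (suc i) + (w zero + cofactorsℤ m · (w ∘ suc)))
  = β ▹ α , (λ { zero → first ; (suc i) → rest i }) , total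
  where
  N = + sylvester-product m
  T = cofactorsℤ m · (w ∘ suc)
  A = sum (cofactorsℤ m)
  β = w zero + T

  sum-α′ : sum α ≡ T + A * β
  sum-α′ = begin
    sum α                                        ≡⟨ sum-α ⟩
    cofactorsℤ m · (λ i → w (suc i) + β)         ≡⟨ ·-distribˡ-+ (cofactorsℤ m) (w ∘ suc) (λ _ → β) ⟩
    T + (sum λ i → cofactorsℤ m i * β)           ≡⟨ cong (_+_ T) (*-distribʳ-sum β (cofactorsℤ m)) ⟨
    T + A * β                                    ∎

  s≡2+A : + sylvester m ≡ 1ℤ + (1ℤ + A)
  s≡2+A = trans (+sylvester m) (cong (_+_ 1ℤ) (sym (sum-cofactors m)))

  first : + sylvester m * β - (β + sum α) ≡ w zero
  first = trans (cong₂ (λ s a → s * β - (β + a)) s≡2+A sum-α′) (identity (w zero) T A)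
    where
    identity : ∀ w t a → (1ℤ + (1ℤ + a)) * (w + t) - (w + t + (t + a * (w + t))) ≡ w
    identity = solve-∀

  rest : ∀ i → + sylvesters m i * α i - (β + sum α) ≡ w (suc i)
  rest i = begin
    + sylvesters m i * α i - (β + sum α)     ≡⟨ regroup (+ sylvesters m i * α i) β (sum α) ⟩
    diag-J (sylvesters m) α i - β            ≡⟨ cong (_- β) (Hα≈w′ i) ⟩
    w (suc i) + β - β                        ≡⟨ cancel (w (suc i)) β ⟩
    w (suc i)                                ∎
    where
    regroup : ∀ a b c → a - (b + c) ≡ a - c - b
    regroup = solve-∀

    cancel : ∀ a b → a + b - b ≡ a
    cancel = solve-∀

  total : β + sum α ≡ N * w zero + (sum λ i → cofactorsℤ (suc m) (suc i) * w (suc i))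
  total = begin
    β + sum α
      ≡⟨ cong (_+_ β) sum-α′ ⟩
    w zero + T + (T + A * (w zero + T))
      ≡⟨ identity (w zero) T A ⟩
    (1ℤ + A) * w zero + (1ℤ + (1ℤ + A)) * T
      ≡⟨ cong₂ (λ n s → n * w zero + s * T) (sum-cofactors m) (sym s≡2+A) ⟩
    N * w zero + + sylvester m * T
      ≡⟨ cong (_+_ (N * w zero)) (·-*ˡ (+ sylvester m) (cofactorsℤ m) (w ∘ suc)) ⟨
    N * w zero + (λ i → + sylvester m * cofactorsℤ m i) · (w ∘ suc)
      ≡⟨ cong (_+_ (N * w zero)) (sum-cong-≋ λ i → cong (_* w (suc i)) (cofactorsℤ-suc m i)) ⟨
    N * w zero + (sum λ i → cofactorsℤ (suc m) (suc i) * w (suc i)) ∎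
    where
    identity : ∀ w t a → w + t + (t + a * (w + t)) ≡ (1ℤ + a) * w + (1ℤ + (1ℤ + a)) * t
    identity = solve-∀

-- Splitting the last unit fraction to obtain a critical group of order c.

module Split (m c M : ℕ) (N≡Mc : sylvester-product m ≡ M ℕ.* c) where

  N : ℕ
  N = sylvester-product m

  private
    A : ℤ
    A = sum (cofactorsℤ m)

    1+A≡Mc : 1ℤ + A ≡ + M * + c
    1+A≡Mc = trans (sum-cofactors m) (trans (cong +_ N≡Mc) (ℤ.pos-* M c))

    +N≡Mc : + N ≡ + M * + c
    +N≡Mc = trans (cong +_ N≡Mc) (ℤ.pos-* M c)

  -- 1/N = 1/(c(M+1)) + 1/(N(M+1)).
  D : Fin (suc (suc m)) → ℕ
  D = c ℕ.* suc M ▹ N ℕ.* suc M ▹ sylvesters m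

  -- lcm(D) = N(M+1), divided by each denominator.
  r : Fin (suc (suc m)) → ℕ
  r = M ▹ 1 ▹ λ i → suc M ℕ.* cofactors m i

  private
    +D₀ : + D zero ≡ + c * (1ℤ + + M)
    +D₀ = ℤ.pos-* c (suc M)

    +D₁ : + D (suc zero) ≡ + M * + c * (1ℤ + + M)
    +D₁ = trans (ℤ.pos-* N (suc M)) (cong (_* (1ℤ + + M)) +N≡Mc)

    rest : Fin m → ℤ
    rest i = + r (suc (suc i))

    +rest : ∀ i → rest i ≡ (1ℤ + + M) * cofactorsℤ m i
    +rest i = ℤ.pos-* (suc M) (cofactors m i)

    +s*cofactor : ∀ i → + sylvesters m i * cofactorsℤ m i ≡ 1ℤ + A
    +s*cofactor i = begin
      + sylvesters m i * cofactorsℤ m i       ≡⟨ ℤ.pos-* (sylvesters m i) (cofactors m i) ⟨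
      + (sylvesters m i ℕ.* cofactors m i)    ≡⟨ cong +_ (sylvesters*cofactors m i) ⟩
      + N                                     ≡⟨ sum-cofactors m ⟨
      1ℤ + A                                  ∎

    sum-rest : sum rest ≡ (1ℤ + + M) * A
    sum-rest = trans (sum-cong-≋ +rest) (sym (*-distribˡ-sum (1ℤ + + M) (cofactorsℤ m)))

    sum-r : + M + (1ℤ + sum rest) ≡ (1ℤ + + M) * (1ℤ + A)
    sum-r = trans (cong (λ a → + M + (1ℤ + a)) sum-rest) (identity (+ M) A)
      where
      identity : ∀ m a → m + (1ℤ + (1ℤ + m) * a) ≡ (1ℤ + m) * (1ℤ + a)
      identity = solve-∀

  -- Each product `D i * r i` is the common multiple N(M+1), and so is the sum of `r`, namely M + 1
  -- + (M+1)A with 1 + A = N.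
  diag-J-r≈0 : ∀ i → diag-J D (+_ ∘ r) i ≡ 0ℤ
  diag-J-r≈0 zero = ℤ.i≡j⇒i-j≡0 (begin
    + D zero * + M                 ≡⟨ cong (_* + M) +D₀ ⟩
    + c * (1ℤ + + M) * + M         ≡⟨ identity (+ c) (+ M) ⟩
    (1ℤ + + M) * (+ M * + c)       ≡⟨ cong ((1ℤ + + M) *_) 1+A≡Mc ⟨
    (1ℤ + + M) * (1ℤ + A)          ≡⟨ sum-r ⟨
    + M + (1ℤ + sum rest)          ∎)
    where
    identity : ∀ c m → c * (1ℤ + m) * m ≡ (1ℤ + m) * (m * c)
    identity = solve-∀
  diag-J-r≈0 (suc zero) = ℤ.i≡j⇒i-j≡0 (begin
    + D (suc zero) * 1ℤ            ≡⟨ cong (_* 1ℤ) +D₁ ⟩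
    + M * + c * (1ℤ + + M) * 1ℤ    ≡⟨ identity (+ M * + c) (+ M) ⟩
    (1ℤ + + M) * (+ M * + c)       ≡⟨ cong ((1ℤ + + M) *_) 1+A≡Mc ⟨
    (1ℤ + + M) * (1ℤ + A)          ≡⟨ sum-r ⟨
    + M + (1ℤ + sum rest)          ∎)
    where
    identity : ∀ a m → a * (1ℤ + m) * 1ℤ ≡ (1ℤ + m) * a
    identity = solve-∀
  diag-J-r≈0 (suc (suc i)) = ℤ.i≡j⇒i-j≡0 (begin
    + sylvesters m i * rest i                            ≡⟨ cong (_*_ (+ sylvesters m i)) (+rest i) ⟩
    + sylvesters m i * ((1ℤ + + M) * cofactorsℤ m i)     ≡⟨ *-swap (+ sylvesters m i) (1ℤ + + M) (cofactorsℤ m i) ⟩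
    (1ℤ + + M) * (+ sylvesters m i * cofactorsℤ m i)     ≡⟨ cong ((1ℤ + + M) *_) (+s*cofactor i) ⟩
    (1ℤ + + M) * (1ℤ + A)                                ≡⟨ sum-r ⟨
    + M + (1ℤ + sum rest)                                ∎)

  cyclic : Cyclic c (diag-J D) (+_ ∘ r)
  cyclic = record
    { φ     = φ
    ; τ     = τ
    ; fφ≈cτ = fφ≈cτ
    ; φ·τ≡1 = cong (λ a → 1ℤ + (0ℤ + a)) (·-zeroʳ (cofactorsℤ m))
    ; solve = solve
    }
    where
    φ τ : Fin (suc (suc m)) → ℤ
    φ = 1ℤ ▹ 0ℤ ▹ cofactorsℤ m
    -- This is `diag-J D φ` divided by c. As `sum φ = N = M c`, the rows are c(M+1) - Mc = c, then
    -- -Mc, then N - N = 0.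
    τ = 1ℤ ▹ - (+ M) ▹ λ _ → 0ℤ

    sum-φ : sum φ ≡ 1ℤ + A
    sum-φ = cong (_+_ 1ℤ) (ℤ.+-identityˡ A)

    fφ≈cτ : ∀ i → diag-J D φ i ≡ + c * τ i
    fφ≈cτ zero = trans (cong₂ (λ a b → a * 1ℤ - b) +D₀ (trans sum-φ 1+A≡Mc)) (identity (+ c) (+ M))
      where
      identity : ∀ c m → c * (1ℤ + m) * 1ℤ - m * c ≡ c * 1ℤ
      identity = solve-∀
    fφ≈cτ (suc zero) = trans (cong (_-_ (+ D (suc zero) * 0ℤ)) (trans sum-φ 1+A≡Mc)) (identity (+ D (suc zero)) (+ c) (+ M))
      where
      identity : ∀ d c m → d * 0ℤ - m * c ≡ c * - m
      identity = solve-∀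
    fφ≈cτ (suc (suc i)) = trans (ℤ.i≡j⇒i-j≡0 (trans (+s*cofactor i) (sym sum-φ))) (sym (ℤ.*-zeroʳ (+ c)))

    solve : ∀ w → (+_ ∘ r) · w ≡ 0ℤ → φ · w ≡ 0ℤ → ∃[ α ] (∀ i → diag-J D α i ≡ w i)
    solve w r·w≡0 φ·w≡0
      with α , Hα≈w , sum-α ← sylvester-solve m (λ i → w (suc (suc i)))
      -- With zeros in front, the later rows are the unimodular Sylvester system and the first two
      -- both equal `- sum α = - t`. The hypothesis on `φ` gives w₀ = -t, and then the one on `r`, M
      -- w₀ + w₁ + (M+1)t = 0, gives w₁ = -t.
      = 0ℤ ▹ 0ℤ ▹ α , λ
        { zero          → trans (vanish (+ D zero) (sum α)) (trans (cong -_ sum-α) (sym w₀≡-t))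
        ; (suc zero)    → trans (vanish (+ D (suc zero)) (sum α)) (trans (cong -_ sum-α) (sym w₁≡-t))
        ; (suc (suc i)) → trans (cong (_-_ (+ sylvesters m i * α i)) (zeros (sum α))) (Hα≈w i)
        }
      where
      w₀ = w zero
      w₁ = w (suc zero)
      t  = cofactorsℤ m · (λ i → w (suc (suc i)))

      zeros : ∀ s → 0ℤ + (0ℤ + s) ≡ s
      zeros = solve-∀

      vanish : ∀ d s → d * 0ℤ - (0ℤ + (0ℤ + s)) ≡ - s
      vanish = solve-∀

      w₀≡-t : w₀ ≡ - t
      w₀≡-t = begin
        w₀                                   ≡⟨ isolate w₀ w₁ t ⟩
        1ℤ * w₀ + (0ℤ * w₁ + t) - t          ≡⟨ cong (_- t) φ·w≡0 ⟩
        0ℤ - t                               ≡⟨ ℤ.+-identityˡ (- t) ⟩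
        - t                                  ∎
        where
        isolate : ∀ a b t → a ≡ 1ℤ * a + (0ℤ * b + t) - t
        isolate = solve-∀

      rest·w : (sum λ i → rest i * w (suc (suc i))) ≡ (1ℤ + + M) * t
      rest·w = trans (sum-cong-≋ λ i → cong (_* w (suc (suc i))) (+rest i))
                     (·-*ˡ (1ℤ + + M) (cofactorsℤ m) (λ i → w (suc (suc i))))

      w₁≡-t : w₁ ≡ - t
      w₁≡-t = begin
        w₁
          ≡⟨ isolate w₁ (+ M) t ⟩
        + M * - t + (1ℤ * w₁ + (1ℤ + + M) * t) - t
          ≡⟨ cong₂ (λ a b → + M * a + (1ℤ * w₁ + b) - t) (sym w₀≡-t) (sym rest·w) ⟩
        + M * w₀ + (1ℤ * w₁ + (sum λ i → rest i * w (suc (suc i)))) - t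
          ≡⟨ cong (_- t) r·w≡0 ⟩
        0ℤ - t
          ≡⟨ ℤ.+-identityˡ (- t) ⟩
        - t ∎
        where
        isolate : ∀ a m t → a ≡ m * - t + (1ℤ * a + (1ℤ + m) * t) - t
        isolate = solve-∀

  0<Mc : 0 < M ℕ.* c
  0<Mc = subst (0 <_) N≡Mc (sylvester-product-positive m)

  r-positive : ∀ i → 0 < r i
  r-positive zero          = ℕ.>-nonZero⁻¹ M {{ℕ.m*n≢0⇒m≢0 M {{ℕ.>-nonZero 0<Mc}}}}
  r-positive (suc zero)    = z<s
  r-positive (suc (suc i)) = ℕ.*-mono-< (z<s {M}) (cofactors-positive m i)

  r-primitive : ∀ k → (∀ i → k ∣ r i) → k ≡ 1
  r-primitive k k∣r = ∣1⇒≡1 (k∣r (suc zero))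

  module _ (0<c : 0 < c) where

    D-positive : ∀ i → 0 < D i
    D-positive zero          = ℕ.*-mono-< 0<c (z<s {M})
    D-positive (suc zero)    = ℕ.*-mono-< (sylvester-product-positive m) (z<s {M})
    D-positive (suc (suc i)) = sylvesters-positive m i

    onStar : IsCriticalGroupOn (ℤ/ c) (S (suc (suc m)))
    onStar = egyptian⇒onStar 0<c D r D-positive r-positive r-primitive diag-J-r≈0 cyclic

    onComplete : IsCriticalGroupOn (ℤ/ c) (K (suc (suc m)))
    onComplete = egyptian⇒onComplete 0<c D r D-positive r-positive r-primitive diag-J-r≈0 cyclic

-- Divisibility by distinct primes, and the conclusion.

sylvester-product-∣-+ : ∀ j m → sylvester-product m ∣ sylvester-product (j ℕ.+ m)
sylvester-product-∣-+ zero    m = ∣-refl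
sylvester-product-∣-+ (suc j) m = ∣-trans (sylvester-product-∣-+ j m) (n∣m*n (sylvester (j ℕ.+ m)))

-- Write `n = q a`; since `b` is coprime to `a`, it must divide `q`.
coprime-*-∣ : ∀ {a b n} → Coprime a b → a ∣ n → b ∣ n → a ℕ.* b ∣ n
coprime-*-∣ {a} {b} a⊥b (divides q refl) b∣qa =
  subst (a ℕ.* b ∣_) (ℕ.*-comm a q)
    (*-monoʳ-∣ a (coprime-divisor (λ (d∣b , d∣a) → a⊥b (d∣a , d∣b)) (subst (b ∣_) (ℕ.*-comm q a) b∣qa)))

prime-∣-product⇒∈ : ∀ {p ps} → Prime p → All Prime ps → p ∣ product ps → p ∈ ps
prime-∣-product⇒∈ p-prime [] p∣1 = contradiction (subst Prime (∣1⇒≡1 p∣1) p-prime) ¬prime[1]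
prime-∣-product⇒∈ {p} {q ∷ qs} p-prime (q-prime ∷ qs-prime) p∣qqs
  with euclidsLemma q (product qs) p-prime p∣qqs
... | inj₂ p∣qs = there (prime-∣-product⇒∈ p-prime qs-prime p∣qs)
... | inj₁ p∣q with prime⇒irreducible q-prime p∣q
...   | inj₁ refl = contradiction p-prime ¬prime[1]
...   | inj₂ p≡q  = here p≡q

prime∤⇒coprime : ∀ {p n} → Prime p → ¬ p ∣ n → Coprime p n
prime∤⇒coprime p-prime p∤n (d∣p , d∣n) with prime⇒irreducible p-prime d∣p
... | inj₁ d≡1  = d≡1
... | inj₂ refl = contradiction d∣n p∤n

-- The Sylvester products form a divisibility chain, so a single large index serves all the primes;
-- distinctness makes each prime coprime to the product of the others.
product-∣-sylvester-product : ∀ ps → Unique ps → All 𝒮𝒫 ps → ∃[ m ] product ps ∣ sylvester-product m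
product-∣-sylvester-product [] [] [] = 0 , 1∣ 1
product-∣-sylvester-product (p ∷ ps) (p∉ps ∷ ps!) ((p-prime , k , p∣s) ∷ ps∈𝒮𝒫)
  with m , ps∣N ← product-∣-sylvester-product ps ps! ps∈𝒮𝒫
  -- `sylvester k` first occurs as a factor at index `suc k`; adding `m` reaches an index past both
  -- requirements.
  = m ℕ.+ suc k , coprime-*-∣ p⊥ps
      (∣-trans (∣-trans p∣s (m∣m*n (sylvester-product k))) (sylvester-product-∣-+ m (suc k)))
      (subst (λ j → product ps ∣ sylvester-product j) (ℕ.+-comm (suc k) m)
        (∣-trans ps∣N (sylvester-product-∣-+ (suc k) m)))
  where
  p⊥ps : Coprime p (product ps)
  p⊥ps = prime∤⇒coprime p-prime λ p∣ps →
    All.lookup p∉ps (prime-∣-product⇒∈ p-prime (All.map proj₁ ps∈𝒮𝒫) p∣ps) refl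

proposition15 : (ps : List ℕ) → Unique ps → All 𝒮𝒫 ps →
    ∃[ n ] Σ[ n≢0 ∈ NonZero n ]
    (IsCriticalGroupOn (ℤ/ product ps) (S n) ×
    IsCriticalGroupOn (ℤ/ product ps) (K n {{n≢0}}))
proposition15 ps ps! ps∈𝒮𝒫 =
  let m , divides M N≡Mc = product-∣-sylvester-product ps ps! ps∈𝒮𝒫
      open Split m (product ps) M N≡Mc
      0<c = productOfPrimes≥1 (All.map proj₁ ps∈𝒮𝒫)
  -- The expansion has `m` Sylvester denominators and the two new ones, which count the leaves of
  -- the star and the vertices of the complete graph.
  in suc (suc m) , _ , onStar 0<c , onComplete 0<c
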